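{- The following properties hold: (i) $\mathbb{WGAO}\subsetneq\mathbb{DGAO}$; (ii) $\mathbb{WGAO}\cap\mathbb{FSDGAO}\neq\emptyset$; (iii) $\mathbb{WGAO}\cap\mathbb{FSDGAO}\subsetneq\mathbb{FSDGAO}$; (iv) $\mathbb{WGAO}\setminus\mathbb{FSGAO}\neq\emptyset$; (v) $\mathbb{BAO}\subsetneq(\mathbb{WGAO}\cap\mathbb{FSGAO})$.
   Context: A G\"odel algebra is a Heyting algebra $\mathbf{A}=(A,\wedge,\vee,\to,\bot,\top)$ satisfying prelinearity $(a\to b)\vee(b\to a)=\top$; $\neg x=x\to\bot$. A GAO (G\"odel algebra with operators) is a triple $(\mathbf{A},\Box,\Diamond)$ with $\mathbf{A}$ a G\"odel algebra and $\Box,\Diamond:A\to A$ satisfying $\Box\top=\top$, $\Box(x\wedge y)=\Box x\wedge\Box y$, $\Diamond\bot=\bot$, $\Diamond(x\vee y)=\Diamond x\vee\Diamond y$. The following are classes (varieties) of GAOs: $\mathbb{DGAO}$: GAOs satisfying, for all $a,b$, $\Box(a\vee b)\leq\Box a\vee\Diamond b$ and $\Box a\wedge\Diamond b\leq\Diamond(a\wedge b)$. $\mathbb{FSGAO}$: GAOs satisfying, for all $a,b$, $\Diamond(a\to b)\leq(\Box a\to\Diamond b)$ and $(\Diamond a\to\Box b)\leq\Box(a\to b)$. $\mathbb{FSDGAO}=\mathbb{DGAO}\cap\mathbb{FSGAO}$. $\mathbb{WGAO}$: algebras in $\mathbb{DGAO}$ satisfying, for all $x$, $\Box x\vee\neg\Box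 x=\top$ and $\Diamond x\vee\neg\Diamond x=\top$. $\mathbb{BAO}$: Boolean algebras with operators, i.e. GAOs whose underlying G\"odel algebra is a Boolean algebra and in which $\Diamond a=\neg\Box\neg a$ for all $a$. -}

module Defs where

open import Algebra.Core using (Op₁)
open import Data.Product using (_×_)
open import Level using (Level; suc; _⊔_)
open import Relation.Binary.Lattice using (HeytingAlgebra; IsBooleanAlgebra)
import Relation.Binary.Lattice.Properties.HeytingAlgebra as HeytingProperties
open import Relation.Unary using (Pred; _∩_; _∖_; _⊆_; Satisfiable)

record GodelAlgebra c ℓ₁ ℓ₂ : Set (suc (c ⊔ ℓ₁ ⊔ ℓ₂)) where
  field
    heytingAlgebra : HeytingAlgebra c ℓ₁ ℓ₂

  open HeytingAlgebra heytingAlgebra public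
  -- ¬ x = x ⇨ ⊥
  open HeytingProperties heytingAlgebra public using (¬_)

  field
    prelinear : ∀ x y → (x ⇨ y) ∨ (y ⇨ x) ≈ ⊤

-- The carrier is a setoid, so □ and ◇ are required to respect _≈_:
-- this is what makes them operations on the algebra.
record GAO c ℓ₁ ℓ₂ : Set (suc (c ⊔ ℓ₁ ⊔ ℓ₂)) where
  infix 8 □_ ◇_
  field
    godelAlgebra : GodelAlgebra c ℓ₁ ℓ₂

  open GodelAlgebra godelAlgebra public

  field
    □_     : Op₁ Carrier
    ◇_     : Op₁ Carrier
    □-cong : ∀ {x y} → x ≈ y → □ x ≈ □ y
    ◇-cong : ∀ {x y} → x ≈ y → ◇ x ≈ ◇ y
    □-⊤    : □ ⊤ ≈ ⊤
    □-∧    : ∀ x y → □ (x ∧ y) ≈ □ x ∧ □ y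
    ◇-⊥    : ◇ ⊥ ≈ ⊥
    ◇-∨    : ∀ x y → ◇ (x ∨ y) ≈ ◇ x ∨ ◇ y

-- Classes of algebras are predicates on the type of all GAOs at fixed, but
-- arbitrary, universe levels.
module Classes (c ℓ₁ ℓ₂ : Level) where

  record DGAO (A : GAO c ℓ₁ ℓ₂) : Set (c ⊔ ℓ₁ ⊔ ℓ₂) where
    open GAO A
    field
      □-∨-≤ : ∀ a b → □ (a ∨ b) ≤ □ a ∨ ◇ b
      ∧-◇-≤ : ∀ a b → □ a ∧ ◇ b ≤ ◇ (a ∧ b)

  record FSGAO (A : GAO c ℓ₁ ℓ₂) : Set (c ⊔ ℓ₁ ⊔ ℓ₂) where
    open GAO A
    field
      ◇-⇨-≤ : ∀ a b → ◇ (a ⇨ b) ≤ (□ a ⇨ ◇ b)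
      ⇨-□-≤ : ∀ a b → (◇ a ⇨ □ b) ≤ □ (a ⇨ b)

  FSDGAO : Pred (GAO c ℓ₁ ℓ₂) (c ⊔ ℓ₁ ⊔ ℓ₂)
  FSDGAO = DGAO ∩ FSGAO

  record WGAO (A : GAO c ℓ₁ ℓ₂) : Set (c ⊔ ℓ₁ ⊔ ℓ₂) where
    open GAO A
    field
      dgao      : DGAO A
      □-boolean : ∀ x → □ x ∨ ¬ (□ x) ≈ ⊤
      ◇-boolean : ∀ x → ◇ x ∨ ¬ (◇ x) ≈ ⊤

  record BAO (A : GAO c ℓ₁ ℓ₂) : Set (c ⊔ ℓ₁ ⊔ ℓ₂) where
    open GAO A
    field
      isBooleanAlgebra : IsBooleanAlgebra _≈_ _≤_ _∨_ _∧_ ¬_ ⊤ ⊥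
      ◇-dual           : ∀ a → ◇ a ≈ ¬ (□ (¬ a))

infix 4 _⊊_

-- Proper inclusion, with an explicit element of the difference. This implies
-- the library's P ⊂ Q, which only asks for the negation of Q ⊆ P.
_⊊_ : ∀ {a p q} {A : Set a} → Pred A p → Pred A q → Set (a ⊔ p ⊔ q)
P ⊊ Q = P ⊆ Q × Satisfiable (Q ∖ P)

{-# OPTIONS --safe #-}

-- The D-axioms hold whenever □ and ◇ are the same bounded lattice endomorphism f,
-- and they imply the first FS-axiom. On the three-element chain, f = id separates
-- WGAO from DGAO and FSDGAO, and f collapsing ½ to ⊥ separates WGAO from FSGAO:
-- f ½ ⇨ f ⊥ = ⊤ although f (½ ⇨ ⊥) = ⊥. The operators of the empty accessibility
-- relation, □ = ⊤ and ◇ = ⊥, satisfy all axioms over any Gödel algebra, in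
-- particular over the chain, which is not Boolean.
module Submission where

open import Defs
open import Data.Product using (_×_; _,_)
open import Function using (id; const)
open import Level using (Level; Lift; lift; lower)
open import Relation.Binary.Lattice using (IsBooleanAlgebra)
import Relation.Binary.Lattice.Properties.BoundedJoinSemilattice as BoundedJoinProperties
import Relation.Binary.Lattice.Properties.BoundedLattice as BoundedLatticeProperties
import Relation.Binary.Lattice.Properties.HeytingAlgebra as HeytingProperties
import Relation.Binary.Lattice.Properties.JoinSemilattice as JoinProperties
import Relation.Binary.Lattice.Properties.MeetSemilattice as MeetProperties
open import Relation.Binary.PropositionalEquality
  using (_≡_; refl; sym; trans; cong)
open import Relation.Nullary using (¬_)
open import Relation.Unary using (_∩_; _∖_; Satisfiable)

private
  variable
    c ℓ₁ ℓ₂ : Level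

-- Monotone operators and the first FS-axiom.

module GAOProperties (A : GAO c ℓ₁ ℓ₂) where
  open GAO A renaming (trans to ≤-trans; refl to ≤-refl)
  open MeetProperties meetSemilattice public using (∧-monotonic; ∧-comm; y≤x⇒x∧y≈y)
  open JoinProperties joinSemilattice public using (x≤y⇒x∨y≈y)

  □-monotonic : ∀ {x y} → x ≤ y → □ x ≤ □ y
  □-monotonic {x} {y} x≤y = ≤-trans
    (reflexive (Eq.trans (□-cong (Eq.sym (y≤x⇒x∧y≈y x≤y))) (□-∧ y x)))
    (x∧y≤x (□ y) (□ x))

  ◇-monotonic : ∀ {x y} → x ≤ y → ◇ x ≤ ◇ y
  ◇-monotonic {x} {y} x≤y = ≤-trans (x≤x∨y (◇ x) (◇ y))
    (reflexive (Eq.trans (Eq.sym (◇-∨ x y)) (◇-cong (x≤y⇒x∨y≈y x≤y))))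

module _ {A : GAO c ℓ₁ ℓ₂} (dgao : Classes.DGAO c ℓ₁ ℓ₂ A) where
  open GAO A renaming (trans to ≤-trans; refl to ≤-refl)
  open GAOProperties A
  open HeytingProperties heytingAlgebra using (⇨-applyʳ)
  open Classes.DGAO dgao

  -- By residuation it suffices to bound `□ a ∧ ◇ (a ⇨ b)`. The second D-axiom moves `a` under the
  -- diamond, where modus ponens and monotonicity of `◇_` leave `◇ b`.
  DGAO⇒◇-⇨-≤ : ∀ a b → ◇ (a ⇨ b) ≤ (□ a ⇨ ◇ b)
  DGAO⇒◇-⇨-≤ a b = transpose-⇨ (≤-trans (reflexive (∧-comm _ _))
    (≤-trans (∧-◇-≤ a (a ⇨ b)) (◇-monotonic (⇨-applyʳ ≤-refl))))

-- Boolean algebras with operators.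

module _ {A : GAO c ℓ₁ ℓ₂} (bao : Classes.BAO c ℓ₁ ℓ₂ A) where
  open Classes c ℓ₁ ℓ₂
  open GAO A renaming (trans to ≤-trans; refl to ≤-refl; ¬_ to ∼_)
  open GAOProperties A
  open HeytingProperties heytingAlgebra
    using (∧-distribˡ-∨-≤; ⇨-applyˡ; ⇨-applyʳ; y≤x⇨y; ⇨ʳ-covariant)
  open BAO bao

  -- The implication of `IsBooleanAlgebra` is by definition `∼ x ∨ y`, so residuating `⊤ ∧ x ≤ x`
  -- there yields `⊤ ≤ ∼ x ∨ x`.
  excludedMiddle : ∀ x → x ∨ ∼ x ≈ ⊤
  excludedMiddle x = antisym (maximum _)
    (≤-trans (IsBooleanAlgebra.transpose-⇨ isBooleanAlgebra (x∧y≤y ⊤ x))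
      (∨-least (y≤x∨y _ _) (x≤x∨y _ _)))

  -- Excluded middle and distributivity split `y` in two. Below, `x` is always some `□ (∼ a)`,
  -- because its complement is `◇ a` by duality.
  ≤-byCases : ∀ x {y z} → y ∧ x ≤ z → y ∧ ∼ x ≤ z → y ≤ z
  ≤-byCases x {y} p q = ≤-trans
    (∧-greatest ≤-refl (≤-trans (maximum y) (reflexive (Eq.sym (excludedMiddle x)))))
    (≤-trans (∧-distribˡ-∨-≤ y x (∼ x)) (∨-least p q))

  BAO⇒DGAO : DGAO A
  BAO⇒DGAO = record
    -- If `□ (∼ b)`, the boxes merge and disjunctive syllogism under the box gives `□ a`; otherwise
    -- duality gives `◇ b`.
    { □-∨-≤ = λ a b → ≤-byCases (□ (∼ b))
        (≤-trans (reflexive (Eq.sym (□-∧ _ _)))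
          (≤-trans (□-monotonic (transpose-∧ (∨-least
              (transpose-⇨ (x∧y≤x a (∼ b)))
              (transpose-⇨ (≤-trans (⇨-applyʳ ≤-refl) (minimum a))))))
            (x≤x∨y _ _)))
        (≤-trans (x∧y≤y _ _) (≤-trans (reflexive (Eq.sym (◇-dual b))) (y≤x∨y _ _)))
    -- By duality the goal is to refute `□ (∼ (a ∧ b))`: together with `□ a` it gives `□ (∼ b)`,
    -- which contradicts `◇ b`.
    ; ∧-◇-≤ = λ a b → ≤-trans
        (transpose-⇨ (≤-trans
          (∧-greatest
            (≤-trans (x∧y≤x _ _) (≤-trans (x∧y≤y _ _) (reflexive (◇-dual b))))
            (≤-trans (∧-monotonic (x∧y≤x _ _) ≤-refl)
              (≤-trans (reflexive (Eq.sym (□-∧ _ _))) (□-monotonic (a∧∼[a∧b]≤∼b a b)))))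
          (⇨-applyˡ ≤-refl)))
        (reflexive (Eq.sym (◇-dual (a ∧ b))))
    }
    where
    a∧∼[a∧b]≤∼b : ∀ a b → a ∧ ∼ (a ∧ b) ≤ ∼ b
    a∧∼[a∧b]≤∼b a b = transpose-⇨ (≤-trans
      (∧-greatest (≤-trans (x∧y≤x _ _) (x∧y≤y _ _)) (∧-monotonic (x∧y≤x _ _) ≤-refl))
      (⇨-applyˡ ≤-refl))

  BAO⇒WGAO : WGAO A
  BAO⇒WGAO = record
    { dgao      = BAO⇒DGAO
    ; □-boolean = λ x → excludedMiddle (□ x)
    ; ◇-boolean = λ x → excludedMiddle (◇ x)
    }

  BAO⇒FSGAO : FSGAO A
  BAO⇒FSGAO = record
    { ◇-⇨-≤ = DGAO⇒◇-⇨-≤ BAO⇒DGAO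
    -- If `□ (∼ a)`, then `∼ a ≤ a ⇨ b` suffices; otherwise `◇ a` holds, the premise yields `□ b`,
    -- and `b ≤ a ⇨ b`.
    ; ⇨-□-≤ = λ a b → ≤-byCases (□ (∼ a))
        (≤-trans (x∧y≤y _ _) (□-monotonic (⇨ʳ-covariant (minimum b))))
        (≤-trans (⇨-applyˡ (reflexive (Eq.sym (◇-dual a)))) (□-monotonic y≤x⇨y))
    }

-- Generic operators on a Gödel algebra.

module EmptyRelation (G : GodelAlgebra c ℓ₁ ℓ₂) where
  open Classes c ℓ₁ ℓ₂
  open GodelAlgebra G
  open MeetProperties meetSemilattice using (∧-idempotent)
  open JoinProperties joinSemilattice using (∨-idempotent)
  open BoundedJoinProperties boundedJoinSemilattice using (identityˡ)
  open BoundedLatticeProperties boundedLattice using (∨-zeroˡ)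
  open HeytingProperties heytingAlgebra using (⇨-unit)

  gao : GAO c ℓ₁ ℓ₂
  gao = record
    { godelAlgebra = G
    ; □_           = const ⊤
    ; ◇_           = const ⊥
    ; □-cong       = λ _ → Eq.refl
    ; ◇-cong       = λ _ → Eq.refl
    ; □-⊤          = Eq.refl
    ; □-∧          = λ _ _ → Eq.sym (∧-idempotent ⊤)
    ; ◇-⊥          = Eq.refl
    ; ◇-∨          = λ _ _ → Eq.sym (∨-idempotent ⊥)
    }

  isWGAO : WGAO gao
  isWGAO = record
    { dgao      = record
      { □-∨-≤ = λ _ _ → x≤x∨y ⊤ ⊥
      ; ∧-◇-≤ = λ _ _ → x∧y≤y ⊤ ⊥
      }
    ; □-boolean = λ _ → ∨-zeroˡ _
    ; ◇-boolean = λ _ → Eq.trans (identityˡ _) ⇨-unit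
    }

  isFSGAO : FSGAO gao
  isFSGAO = record
    { ◇-⇨-≤ = λ _ _ → minimum _
    ; ⇨-□-≤ = λ _ _ → maximum _
    }

module _ (G : GodelAlgebra c ℓ₁ ℓ₂) where
  open GodelAlgebra G

  module Endomorphism
    (f : Carrier → Carrier) (f-cong : ∀ {x y} → x ≈ y → f x ≈ f y)
    (f-⊤ : f ⊤ ≈ ⊤) (f-∧ : ∀ x y → f (x ∧ y) ≈ f x ∧ f y)
    (f-⊥ : f ⊥ ≈ ⊥) (f-∨ : ∀ x y → f (x ∨ y) ≈ f x ∨ f y) where
    open Classes c ℓ₁ ℓ₂

    gao : GAO c ℓ₁ ℓ₂
    gao = record
      { godelAlgebra = G
      ; □_           = f
      ; ◇_           = f
      ; □-cong       = f-cong
      ; ◇-cong       = f-cong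
      ; □-⊤          = f-⊤
      ; □-∧          = f-∧
      ; ◇-⊥          = f-⊥
      ; ◇-∨          = f-∨
      }

    -- With both operators equal to `f`, each D-axiom is one half of the preservation of joins or of
    -- meets.
    isDGAO : DGAO gao
    isDGAO = record
      { □-∨-≤ = λ a b → reflexive (f-∨ a b)
      ; ∧-◇-≤ = λ a b → reflexive (Eq.sym (f-∧ a b))
      }

module Identity (G : GodelAlgebra c ℓ₁ ℓ₂) where
  open Classes c ℓ₁ ℓ₂
  open GodelAlgebra G
  open Endomorphism G id id Eq.refl (λ _ _ → Eq.refl) Eq.refl (λ _ _ → Eq.refl) public

  isFSGAO : FSGAO gao
  isFSGAO = record
    { ◇-⇨-≤ = λ _ _ → reflexive Eq.refl
    ; ⇨-□-≤ = λ _ _ → reflexive Eq.refl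
    }

-- The three-element Gödel chain.

module Chain where
  data Three : Set where
    𝟎 ½ 𝟏 : Three

  infixr 7 _⊓_
  infixr 6 _⊔_
  infixr 5 _⇒_
  infix  4 _≼_

  _⊓_ _⊔_ _⇒_ : Three → Three → Three
  𝟎 ⊓ y = 𝟎
  ½ ⊓ 𝟎 = 𝟎
  ½ ⊓ ½ = ½
  ½ ⊓ 𝟏 = ½
  𝟏 ⊓ y = y

  𝟎 ⊔ y = y
  ½ ⊔ 𝟎 = ½
  ½ ⊔ ½ = ½
  ½ ⊔ 𝟏 = 𝟏
  𝟏 ⊔ y = 𝟏

  𝟎 ⇒ y = 𝟏
  ½ ⇒ 𝟎 = 𝟎
  ½ ⇒ ½ = 𝟏
  ½ ⇒ 𝟏 = 𝟏
  𝟏 ⇒ y = y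

  -- The two bounds hold for arbitrary arguments, so `𝟎 ≼ 𝟏` has two proofs; in exchange `minimum`
  -- and `maximum` need no case split.
  data _≼_ : Three → Three → Set where
    𝟎≼  : ∀ {y} → 𝟎 ≼ y
    ½≼½ : ½ ≼ ½
    ≼𝟏  : ∀ {x} → x ≼ 𝟏

  ≼-refl : ∀ {x} → x ≼ x
  ≼-refl {𝟎} = 𝟎≼
  ≼-refl {½} = ½≼½
  ≼-refl {𝟏} = ≼𝟏

  ≼-reflexive : ∀ {x y} → x ≡ y → x ≼ y
  ≼-reflexive refl = ≼-refl

  ≼-trans : ∀ {x y z} → x ≼ y → y ≼ z → x ≼ z
  ≼-trans 𝟎≼  _  = 𝟎≼
  ≼-trans ½≼½ q  = q
  ≼-trans ≼𝟏  ≼𝟏 = ≼𝟏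

  ≼-antisym : ∀ {x y} → x ≼ y → y ≼ x → x ≡ y
  ≼-antisym 𝟎≼  𝟎≼  = refl
  ≼-antisym ½≼½ _   = refl
  ≼-antisym ≼𝟏  ≼𝟏  = refl

  x⊓y≼x : ∀ x y → x ⊓ y ≼ x
  x⊓y≼x 𝟎 y = 𝟎≼
  x⊓y≼x ½ 𝟎 = 𝟎≼
  x⊓y≼x ½ ½ = ½≼½
  x⊓y≼x ½ 𝟏 = ½≼½
  x⊓y≼x 𝟏 y = ≼𝟏

  x⊓y≼y : ∀ x y → x ⊓ y ≼ y
  x⊓y≼y 𝟎 y = 𝟎≼
  x⊓y≼y ½ 𝟎 = 𝟎≼
  x⊓y≼y ½ ½ = ½≼½
  x⊓y≼y ½ 𝟏 = ≼𝟏
  x⊓y≼y 𝟏 y = ≼-refl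

  ⊓-greatest : ∀ {x y z} → z ≼ x → z ≼ y → z ≼ x ⊓ y
  ⊓-greatest 𝟎≼  _   = 𝟎≼
  ⊓-greatest ½≼½ ½≼½ = ½≼½
  ⊓-greatest ½≼½ ≼𝟏  = ½≼½
  ⊓-greatest ≼𝟏  q   = q

  x≼x⊔y : ∀ x y → x ≼ x ⊔ y
  x≼x⊔y 𝟎 y = 𝟎≼
  x≼x⊔y ½ 𝟎 = ½≼½
  x≼x⊔y ½ ½ = ½≼½
  x≼x⊔y ½ 𝟏 = ≼𝟏
  x≼x⊔y 𝟏 y = ≼𝟏

  y≼x⊔y : ∀ x y → y ≼ x ⊔ y
  y≼x⊔y 𝟎 y = ≼-refl
  y≼x⊔y ½ 𝟎 = 𝟎≼
  y≼x⊔y ½ ½ = ½≼½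
  y≼x⊔y ½ 𝟏 = ≼𝟏
  y≼x⊔y 𝟏 y = ≼𝟏

  ⊔-least : ∀ {x y z} → x ≼ z → y ≼ z → x ⊔ y ≼ z
  ⊔-least 𝟎≼  q   = q
  ⊔-least ½≼½ 𝟎≼  = ½≼½
  ⊔-least ½≼½ ½≼½ = ½≼½
  ⊔-least ≼𝟏  _   = ≼𝟏

  transpose-⇒ : ∀ w x y → w ⊓ x ≼ y → w ≼ x ⇒ y
  transpose-⇒ w 𝟎 y _ = ≼𝟏
  -- For any other `w` the hypothesis is `½ ≼ 𝟎`, which is empty.
  transpose-⇒ 𝟎 ½ 𝟎 _ = 𝟎≼
  transpose-⇒ w ½ ½ _ = ≼𝟏
  transpose-⇒ w ½ 𝟏 _ = ≼𝟏
  transpose-⇒ 𝟎 𝟏 y _ = 𝟎≼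
  transpose-⇒ ½ 𝟏 y p = p
  transpose-⇒ 𝟏 𝟏 y p = p

  transpose-⊓ : ∀ w x y → w ≼ x ⇒ y → w ⊓ x ≼ y
  transpose-⊓ w 𝟎 y _ = ≼-trans (x⊓y≼y w 𝟎) 𝟎≼
  transpose-⊓ 𝟎 ½ 𝟎 _ = 𝟎≼
  transpose-⊓ w ½ ½ _ = x⊓y≼y w ½
  transpose-⊓ w ½ 𝟏 _ = ≼𝟏
  transpose-⊓ w 𝟏 y p = ≼-trans (x⊓y≼x w 𝟏) p

  ⇒-prelinear : ∀ x y → (x ⇒ y) ⊔ (y ⇒ x) ≡ 𝟏
  ⇒-prelinear 𝟎 y = refl
  ⇒-prelinear ½ 𝟎 = refl
  ⇒-prelinear ½ ½ = refl
  ⇒-prelinear ½ 𝟏 = refl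
  ⇒-prelinear 𝟏 𝟎 = refl
  ⇒-prelinear 𝟏 ½ = refl
  ⇒-prelinear 𝟏 𝟏 = refl

  -- This is the Baaz projection onto the Boolean elements `𝟎` and `𝟏`. It is monotone, hence a
  -- lattice map on a chain, but it does not preserve `_⇒_`.
  collapse : Three → Three
  collapse 𝟎 = 𝟎
  collapse ½ = 𝟎
  collapse 𝟏 = 𝟏

  collapse-⊓ : ∀ x y → collapse (x ⊓ y) ≡ collapse x ⊓ collapse y
  collapse-⊓ 𝟎 y = refl
  collapse-⊓ ½ 𝟎 = refl
  collapse-⊓ ½ ½ = refl
  collapse-⊓ ½ 𝟏 = refl
  collapse-⊓ 𝟏 y = refl

  collapse-⊔ : ∀ x y → collapse (x ⊔ y) ≡ collapse x ⊔ collapse y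
  collapse-⊔ 𝟎 y = refl
  collapse-⊔ ½ 𝟎 = refl
  collapse-⊔ ½ ½ = refl
  collapse-⊔ ½ 𝟏 = refl
  collapse-⊔ 𝟏 y = refl

  collapse-boolean : ∀ x → collapse x ⊔ (collapse x ⇒ 𝟎) ≡ 𝟏
  collapse-boolean 𝟎 = refl
  collapse-boolean ½ = refl
  collapse-boolean 𝟏 = refl

open Chain

-- `Three`, its equality and its order live at level zero; each is lifted separately to reach
-- arbitrary levels.
chain : ∀ c ℓ₁ ℓ₂ → GodelAlgebra c ℓ₁ ℓ₂
chain c ℓ₁ ℓ₂ = record
  { heytingAlgebra = record
    { Carrier = Lift c Three
    ; _≈_     = λ x y → Lift ℓ₁ (lower x ≡ lower y)
    ; _≤_     = λ x y → Lift ℓ₂ (lower x ≼ lower y)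
    ; _∨_     = λ x y → lift (lower x ⊔ lower y)
    ; _∧_     = λ x y → lift (lower x ⊓ lower y)
    ; _⇨_     = λ x y → lift (lower x ⇒ lower y)
    ; ⊤       = lift 𝟏
    ; ⊥       = lift 𝟎
    ; isHeytingAlgebra = record
      { isBoundedLattice = record
        { isLattice = record
          { isPartialOrder = record
            { isPreorder = record
              { isEquivalence = record
                { refl  = lift refl
                ; sym   = λ p → lift (sym (lower p))
                ; trans = λ p q → lift (trans (lower p) (lower q))
                }
              ; reflexive = λ p → lift (≼-reflexive (lower p))
              ; trans     = λ p q → lift (≼-trans (lower p) (lower q))
              }
            ; antisym = λ p q → lift (≼-antisym (lower p) (lower q))
            }
          ; supremum = λ x y →
              lift (x≼x⊔y (lower x) (lower y)) ,
              lift (y≼x⊔y (lower x) (lower y)) ,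
              λ _ p q → lift (⊔-least (lower p) (lower q))
          ; infimum = λ x y →
              lift (x⊓y≼x (lower x) (lower y)) ,
              lift (x⊓y≼y (lower x) (lower y)) ,
              λ _ p q → lift (⊓-greatest (lower p) (lower q))
          }
        ; maximum = λ _ → lift ≼𝟏
        ; minimum = λ _ → lift 𝟎≼
        }
      ; exponential = λ w x y →
          (λ p → lift (transpose-⇒ (lower w) (lower x) (lower y) (lower p))) ,
          (λ p → lift (transpose-⊓ (lower w) (lower x) (lower y) (lower p)))
      }
    }
  ; prelinear = λ x y → lift (⇒-prelinear (lower x) (lower y))
  }

-- Separating algebras over the chain.

module _ (c ℓ₁ ℓ₂ : Level) where
  open Classes c ℓ₁ ℓ₂

  private
    module Id    = Identity (chain c ℓ₁ ℓ₂)
    module Empty = EmptyRelation (chain c ℓ₁ ℓ₂)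
    module Collapse = Endomorphism (chain c ℓ₁ ℓ₂)
      (λ x → lift (collapse (lower x))) (λ p → lift (cong collapse (lower p)))
      (lift refl) (λ x y → lift (collapse-⊓ (lower x) (lower y)))
      (lift refl) (λ x y → lift (collapse-⊔ (lower x) (lower y)))

  identity∉WGAO : ¬ WGAO Id.gao
  -- Since `½ ⇒ 𝟎` is `𝟎`, the join of `½` with its negation is `½`, and the equation reduces to
  -- `½ ≡ 𝟏`.
  identity∉WGAO w with WGAO.□-boolean w (lift ½)
  ... | lift ()

  empty∉BAO : ¬ BAO Empty.gao
  empty∉BAO b with excludedMiddle b (lift ½)
  ... | lift ()

  collapse∈WGAO : WGAO Collapse.gao
  collapse∈WGAO = record
    { dgao      = Collapse.isDGAO
    ; □-boolean = λ x → lift (collapse-boolean (lower x))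
    ; ◇-boolean = λ x → lift (collapse-boolean (lower x))
    }

  collapse∉FSGAO : ¬ FSGAO Collapse.gao
  -- Only the second FS-axiom can fail, by `DGAO⇒◇-⇨-≤`; this instance reduces to `𝟏 ≼ 𝟎`.
  collapse∉FSGAO fs with FSGAO.⇨-□-≤ fs (lift ½) (lift 𝟎)
  ... | lift ()

  WGAO⊊DGAO : WGAO ⊊ DGAO
  WGAO⊊DGAO = WGAO.dgao , Id.gao , Id.isDGAO , identity∉WGAO

  WGAO∩FSDGAO-satisfiable : Satisfiable (WGAO ∩ FSDGAO)
  WGAO∩FSDGAO-satisfiable =
    Empty.gao , Empty.isWGAO , WGAO.dgao Empty.isWGAO , Empty.isFSGAO

  WGAO∩FSDGAO⊊FSDGAO : (WGAO ∩ FSDGAO) ⊊ FSDGAO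
  WGAO∩FSDGAO⊊FSDGAO =
    (λ (_ , fsd) → fsd) ,
    Id.gao , (Id.isDGAO , Id.isFSGAO) , λ (w , _) → identity∉WGAO w

  WGAO∖FSGAO-satisfiable : Satisfiable (WGAO ∖ FSGAO)
  WGAO∖FSGAO-satisfiable = Collapse.gao , collapse∈WGAO , collapse∉FSGAO

  BAO⊊WGAO∩FSGAO : BAO ⊊ (WGAO ∩ FSGAO)
  BAO⊊WGAO∩FSGAO =
    (λ b → BAO⇒WGAO b , BAO⇒FSGAO b) ,
    Empty.gao , (Empty.isWGAO , Empty.isFSGAO) , empty∉BAO

proposition6p19 : (c ℓ₁ ℓ₂ : Level) →
    let open Classes c ℓ₁ ℓ₂ in
    (WGAO ⊊ DGAO)
    × Satisfiable (WGAO ∩ FSDGAO)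
    × ((WGAO ∩ FSDGAO) ⊊ FSDGAO)
    × Satisfiable (WGAO ∖ FSGAO)
    × (BAO ⊊ (WGAO ∩ FSGAO))
proposition6p19 c ℓ₁ ℓ₂ =
  WGAO⊊DGAO c ℓ₁ ℓ₂ ,
  WGAO∩FSDGAO-satisfiable c ℓ₁ ℓ₂ ,
  WGAO∩FSDGAO⊊FSDGAO c ℓ₁ ℓ₂ ,
  WGAO∖FSGAO-satisfiable c ℓ₁ ℓ₂ ,
  BAO⊊WGAO∩FSGAO c ℓ₁ ℓ₂
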